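{- Let $G$ be an esp-digraph. Then $\chi_o(G)\le 7$.
   Context: An oriented graph is a digraph without loops and without pairs of opposite arcs. For a digraph $G=(V,E)$ (parallel arcs allowed; the definitions apply verbatim), an oriented $r$-vertex-coloring is a map $c:V\to\{1,\dots,r\}$ such that (i) $c(u)\ne c(v)$ for every arc $(u,v)\in E$, and (ii) $c(u)\ne c(y)$ for every two arcs $(u,v),(x,y)\in E$ with $c(v)=c(x)$. Equivalently, $c$ is a homomorphism to an oriented graph on $r$ vertices. The oriented chromatic number $\chi_o(G)$ is the smallest $r$ for which such a coloring exists. Edge series-parallel (multi)digraphs (esp-digraphs) are defined recursively, each with a distinguished source and sink: (i) a digraph with two distinct vertices $u,v$ and the single arc $(u,v)$ is an esp-digraph with source $u$ and sink $v$; (ii) if $G_1,G_2$ are vertex-disjoint esp-digraphs, then the parallel composition $G_1\cup G_2$ (identify the source of $G_1$ with the source of $G_2$ and the sink of $G_1$ with the sink of $G_2$; arcs are united, possibly creating parallel arcs) is an esp-digraph with these identified source and sink, and the series composition $G_1\times G_2$ (identify the sink of $G_1$ with the source of $G_2$) is an esp-digraph with source the source of $G_1$ and sink the sink of $G_2$. -}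

module Defs where

open import Data.Fin using (Fin)
open import Data.Nat using (ℕ; _≤_)
open import Data.Product using (∃; _×_)
open import Data.Sum using (_⊎_; inj₁; inj₂)
open import Function.Bundles using (_↔_; _⇔_; Inverse)
open import Function.Definitions using (Injective)
open import Relation.Binary.PropositionalEquality using (_≡_; _≢_)

-- Arcs are named rather than being pairs of vertices, so that parallel arcs
-- are allowed.
record Digraph : Set where
  field
    #vertices : ℕ
    #arcs     : ℕ

  Vertex : Set
  Vertex = Fin #vertices

  Arc : Set
  Arc = Fin #arcs

  field
    tail : Arc → Vertex
    head : Arc → Vertex

open Digraph public

record IsOrientedColoring (G : Digraph) (r : ℕ) (c : Vertex G → Fin r) : Set where
  field
    proper   : ∀ e → c (tail G e) ≢ c (head G e)
    oriented : ∀ e f → c (head G e) ≡ c (tail G f) → c (tail G e) ≢ c (head G f)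

OrientedColorable : Digraph → ℕ → Set
OrientedColorable G r = ∃ λ (c : Vertex G → Fin r) → IsOrientedColoring G r c

-- A relation, because a digraph with a loop or a pair of opposite arcs
-- has no oriented coloring at all.
record IsOrientedChromaticNumber (G : Digraph) (r : ℕ) : Set where
  field
    colorable : OrientedColorable G r
    smallest  : ∀ k → OrientedColorable G k → r ≤ k

-- Gluing G₁ G₂ _~_ G exhibits G as the digraph obtained from disjoint copies
-- of G₁ and G₂ by identifying x in G₁ with y in G₂ exactly when x ~ y, and
-- making no other identification; the arcs of G are the disjoint union of the
-- arcs of G₁ and G₂. This determines G up to isomorphism.
record Gluing (G₁ G₂ : Digraph) (_~_ : Vertex G₁ → Vertex G₂ → Set) (G : Digraph) : Set where
  field
    ι₁ : Vertex G₁ → Vertex G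
    ι₂ : Vertex G₂ → Vertex G
    ι₁-injective : Injective _≡_ _≡_ ι₁
    ι₂-injective : Injective _≡_ _≡_ ι₂
    identified   : ∀ x y → ι₁ x ≡ ι₂ y ⇔ x ~ y
    covered      : ∀ v → (∃ λ x → ι₁ x ≡ v) ⊎ (∃ λ y → ι₂ y ≡ v)

    arcs : (Arc G₁ ⊎ Arc G₂) ↔ Arc G

  open Inverse arcs using (to)

  field
    tail₁ : ∀ e → tail G (to (inj₁ e)) ≡ ι₁ (tail G₁ e)
    head₁ : ∀ e → head G (to (inj₁ e)) ≡ ι₁ (head G₁ e)
    tail₂ : ∀ e → tail G (to (inj₂ e)) ≡ ι₂ (tail G₂ e)
    head₂ : ∀ e → head G (to (inj₂ e)) ≡ ι₂ (head G₂ e)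

record SingleArc (G : Digraph) (u v : Vertex G) : Set where
  field
    distinct    : u ≢ v
    vertices    : ∀ w → w ≡ u ⊎ w ≡ v
    arc         : Arc G
    arc-unique  : ∀ e → e ≡ arc
    tail-arc    : tail G arc ≡ u
    head-arc    : head G arc ≡ v

ParallelComposition : (G₁ : Digraph) (s₁ t₁ : Vertex G₁) (G₂ : Digraph) (s₂ t₂ : Vertex G₂) → Digraph → Set
ParallelComposition G₁ s₁ t₁ G₂ s₂ t₂ =
  Gluing G₁ G₂ (λ x y → (x ≡ s₁ × y ≡ s₂) ⊎ (x ≡ t₁ × y ≡ t₂))

SeriesComposition : (G₁ : Digraph) (t₁ : Vertex G₁) (G₂ : Digraph) (s₂ : Vertex G₂) → Digraph → Set
SeriesComposition G₁ t₁ G₂ s₂ = Gluing G₁ G₂ (λ x y → x ≡ t₁ × y ≡ s₂)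

-- IsEsp G s t: G is an edge series-parallel multidigraph with source s and sink t.
data IsEsp : (G : Digraph) → Vertex G → Vertex G → Set where
  single : ∀ {G u v} → SingleArc G u v → IsEsp G u v

  parallel : ∀ {G₁ s₁ t₁ G₂ s₂ t₂ G} →
             IsEsp G₁ s₁ t₁ → IsEsp G₂ s₂ t₂ →
             (g : ParallelComposition G₁ s₁ t₁ G₂ s₂ t₂ G) →
             IsEsp G (Gluing.ι₁ g s₁) (Gluing.ι₁ g t₁)

  series : ∀ {G₁ s₁ t₁ G₂ s₂ t₂ G} →
           IsEsp G₁ s₁ t₁ → IsEsp G₂ s₂ t₂ →
           (g : SeriesComposition G₁ t₁ G₂ s₂ G) →
           IsEsp G (Gluing.ι₁ g s₁) (Gluing.ι₂ g t₂)

{-# OPTIONS --safe #-}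
-- Suppose every arc x → y of a relation can be replaced by a path x → m → y.
-- Then for every esp-digraph G and every arc x → y some homomorphism from G to
-- the relation sends the source to x and the sink to y: a parallel composition
-- uses x → y for both parts, a series composition uses x → m and m → y. The
-- Paley tournament of order 7 is such a relation, and homomorphisms to a
-- tournament are oriented colorings. Constructively, χ is found by a finite
-- search, r-colorability being decidable.
module Submission where

open import Data.Fin using (Fin; #_; toℕ; finToFun; funToFin)
open import Data.Fin.Properties using (_≟_; all?; any?; finToFun-funToFin)
open import Data.Nat using (ℕ; _+_; _*_; _≤_; _<_; NonZero)
import Data.Nat as ℕ
open import Data.Nat.DivMod using (_%_)
open import Data.Nat.Induction using (<-rec)
open import Data.Nat.Properties using (anyUpTo?; ≮⇒≥)
open import Data.Product using (∃; ∃₂; _×_; _,_; proj₁)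
open import Data.Sum using (_⊎_; inj₁; inj₂; [_,_]′)
open import Data.Vec.Functional using (replicate; updateAt)
open import Data.Vec.Functional.Properties using (updateAt-updates; updateAt-minimal)
open import Defs
open import Function using (_∘_; const; Equivalence; Inverse)
open import Level using (Level; 0ℓ; _⊔_)
open import Relation.Binary using (Rel; Asymmetric; Dense; _Respects_)
open import Relation.Binary.Consequences using (asym⇒irr)
open import Relation.Binary.PropositionalEquality
  using (_≡_; _≢_; _≗_; refl; sym; trans; cong; subst; subst₂; resp₂)
open import Relation.Nullary using (Dec; yes; no)
open import Relation.Nullary.Decidable using (map′; from-yes; ¬?; _×-dec_; _→-dec_)
open import Relation.Unary using (Pred; Decidable)

private
  variable
    a p ℓ : Level
    A     : Set a
    k n r : ℕ
    G G₁ G₂ : Digraph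

IsLeast : Pred ℕ p → Pred ℕ p
IsLeast P m = P m × ∀ k → P k → m ≤ k

∃-least : {P : Pred ℕ p} → Decidable P → ∃ P → ∃ (IsLeast P)
∃-least {P = P} P? (n , Pn) = <-rec (λ n → P n → ∃ (IsLeast P)) descend n Pn
  where
  descend : ∀ n → (∀ {k} → k < n → P k → ∃ (IsLeast P)) → P n → ∃ (IsLeast P)
  descend n rec Pn with anyUpTo? P? n
  ... | yes (k , k<n , Pk) = rec k<n Pk
  ... | no ∄k<n            = n , Pn , λ k Pk → ≮⇒≥ λ k<n → ∄k<n (k , k<n , Pk)

anyFunction? : {P : Pred (Fin k → Fin n) p} → P Respects _≗_ → Decidable P → Dec (∃ P)
anyFunction? P-resp P? =
  map′ (λ (i , Pi) → finToFun i , Pi)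
       (λ (f , Pf) → funToFin f , P-resp (sym ∘ finToFun-funToFin f) Pf)
       (any? (P? ∘ finToFun))

isOrientedColoring? : ∀ G → Decidable (IsOrientedColoring G r)
isOrientedColoring? G c =
  map′ (λ (p , o) → record { proper = p ; oriented = o }) (λ col → proper col , oriented col)
    ((all? λ e → ¬? (c (tail G e) ≟ c (head G e))) ×-dec
     (all? λ e → all? λ f → (c (head G e) ≟ c (tail G f)) →-dec ¬? (c (tail G e) ≟ c (head G f))))
  where open IsOrientedColoring

isOrientedColoring-resp-≗ : IsOrientedColoring G r Respects _≗_
isOrientedColoring-resp-≗ {G} {x = c} {y = d} c≗d col = record
  { proper   = λ e → proper e ∘ reflect
  ; oriented = λ e f h≡t → oriented e f (reflect h≡t) ∘ reflect
  }
  where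
  open IsOrientedColoring col

  reflect : ∀ {u v} → d u ≡ d v → c u ≡ c v
  reflect {u} {v} du≡dv = trans (c≗d u) (trans du≡dv (sym (c≗d v)))

orientedColorable? : ∀ G → Decidable (OrientedColorable G)
orientedColorable? G r = anyFunction? isOrientedColoring-resp-≗ (isOrientedColoring? G)

orientedColorable⇒∃chromaticNumber : OrientedColorable G r → ∃ (IsOrientedChromaticNumber G)
orientedColorable⇒∃chromaticNumber {G} {r} colorable-r =
  let χ , colorable , smallest = ∃-least (orientedColorable? G) (r , colorable-r)
  in  χ , record { colorable = colorable ; smallest = smallest }

IsHomomorphism : Rel A ℓ → (G : Digraph) → (Vertex G → A) → Set ℓ
IsHomomorphism _⟶_ G f = ∀ e → f (tail G e) ⟶ f (head G e)

homomorphism⇒orientedColoring : {_⟶_ : Rel (Fin r) ℓ} {c : Vertex G → Fin r} → Asymmetric _⟶_ →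
                                IsHomomorphism _⟶_ G c → IsOrientedColoring G r c
homomorphism⇒orientedColoring {_⟶_ = _⟶_} asym hom = record
  { proper   = λ e t≡h → asym⇒irr (resp₂ _⟶_) sym asym t≡h (hom e)
  ; oriented = λ e f h≡t t≡h → asym (hom e) (subst₂ _⟶_ (sym h≡t) (sym t≡h) (hom f))
  }

module _ {_~_ : Vertex G₁ → Vertex G₂ → Set} (g : Gluing G₁ G₂ _~_ G)
         {f₁ : Vertex G₁ → A} {f₂ : Vertex G₂ → A} (agree : ∀ {x y} → x ~ y → f₁ x ≡ f₂ y) where
  open Gluing g

  glue : Vertex G → A
  glue v = [ f₁ ∘ proj₁ , f₂ ∘ proj₁ ]′ (covered v)

  glue-ι₁ : glue ∘ ι₁ ≗ f₁
  glue-ι₁ x with covered (ι₁ x)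
  ... | inj₁ (_ , eq) = cong f₁ (ι₁-injective eq)
  ... | inj₂ (y , eq) = sym (agree (Equivalence.to (identified x y) (sym eq)))

  glue-ι₂ : glue ∘ ι₂ ≗ f₂
  glue-ι₂ y with covered (ι₂ y)
  ... | inj₁ (x , eq) = agree (Equivalence.to (identified x y) eq)
  ... | inj₂ (_ , eq) = cong f₂ (ι₂-injective eq)

  glue-isHomomorphism : (_⟶_ : Rel A ℓ) → IsHomomorphism _⟶_ G₁ f₁ → IsHomomorphism _⟶_ G₂ f₂ →
                        IsHomomorphism _⟶_ G glue
  glue-isHomomorphism _⟶_ hom₁ hom₂ e =
    subst Preserved (strictlyInverseˡ e) (preserved (from e))
    where
    open Inverse arcs

    Preserved : Arc G → Set _
    Preserved e = glue (tail G e) ⟶ glue (head G e)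

    preserved : ∀ e → Preserved (to e)
    preserved (inj₁ e) rewrite tail₁ e | head₁ e | glue-ι₁ (tail G₁ e) | glue-ι₁ (head G₁ e) = hom₁ e
    preserved (inj₂ e) rewrite tail₂ e | head₂ e | glue-ι₂ (tail G₂ e) | glue-ι₂ (head G₂ e) = hom₂ e

record TerminalHomomorphism {A : Set a} (_⟶_ : Rel A ℓ) (G : Digraph) (s t : Vertex G) (x y : A) :
       Set (a ⊔ ℓ) where
  field
    map            : Vertex G → A
    isHomomorphism : IsHomomorphism _⟶_ G map
    source↦        : map s ≡ x
    sink↦          : map t ≡ y

module _ {A : Set a} {_⟶_ : Rel A ℓ} where
  open TerminalHomomorphism

  private
    variable
      x y z : A

  singleArc-homomorphism : ∀ {s t} → SingleArc G s t → x ⟶ y → TerminalHomomorphism _⟶_ G s t x y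
  singleArc-homomorphism {G = G} {x} {y} {s} {t} single-arc x⟶y = record
    { map            = f
    ; isHomomorphism = f-hom
    ; source↦        = f-source
    ; sink↦          = f-sink
    }
    where
    open SingleArc single-arc

    f : Vertex G → A
    f = updateAt (replicate _ y) s (const x)

    f-source : f s ≡ x
    f-source = updateAt-updates s (replicate _ y)

    f-sink : f t ≡ y
    f-sink = updateAt-minimal t s (replicate _ y) (distinct ∘ sym)

    f-hom : IsHomomorphism _⟶_ G f
    f-hom e rewrite arc-unique e | tail-arc | head-arc | f-source | f-sink = x⟶y

  parallel-homomorphism : ∀ {s₁ t₁ s₂ t₂} (g : ParallelComposition G₁ s₁ t₁ G₂ s₂ t₂ G) →
                          TerminalHomomorphism _⟶_ G₁ s₁ t₁ x y →
                          TerminalHomomorphism _⟶_ G₂ s₂ t₂ x y →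
                          TerminalHomomorphism _⟶_ G (Gluing.ι₁ g s₁) (Gluing.ι₁ g t₁) x y
  parallel-homomorphism {s₁ = s₁} {t₁} {s₂} {t₂} g h₁ h₂ = record
    { map            = glue g agree
    ; isHomomorphism = glue-isHomomorphism g agree _⟶_ (isHomomorphism h₁) (isHomomorphism h₂)
    ; source↦        = trans (glue-ι₁ g agree s₁) (source↦ h₁)
    ; sink↦          = trans (glue-ι₁ g agree t₁) (sink↦ h₁)
    }
    where
    agree : ∀ {u v} → (u ≡ s₁ × v ≡ s₂) ⊎ (u ≡ t₁ × v ≡ t₂) → map h₁ u ≡ map h₂ v
    agree (inj₁ (refl , refl)) = trans (source↦ h₁) (sym (source↦ h₂))
    agree (inj₂ (refl , refl)) = trans (sink↦ h₁) (sym (sink↦ h₂))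

  series-homomorphism : ∀ {s₁ t₁ s₂ t₂} (g : SeriesComposition G₁ t₁ G₂ s₂ G) →
                        TerminalHomomorphism _⟶_ G₁ s₁ t₁ x y →
                        TerminalHomomorphism _⟶_ G₂ s₂ t₂ y z →
                        TerminalHomomorphism _⟶_ G (Gluing.ι₁ g s₁) (Gluing.ι₂ g t₂) x z
  series-homomorphism {s₁ = s₁} {t₁} {s₂} {t₂} g h₁ h₂ = record
    { map            = glue g agree
    ; isHomomorphism = glue-isHomomorphism g agree _⟶_ (isHomomorphism h₁) (isHomomorphism h₂)
    ; source↦        = trans (glue-ι₁ g agree s₁) (source↦ h₁)
    ; sink↦          = trans (glue-ι₂ g agree t₂) (sink↦ h₂)
    }
    where
    agree : ∀ {u v} → u ≡ t₁ × v ≡ s₂ → map h₁ u ≡ map h₂ v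
    agree (refl , refl) = trans (sink↦ h₁) (sym (source↦ h₂))

  esp-homomorphism : ∀ {s t} → Dense _⟶_ → IsEsp G s t → x ⟶ y → TerminalHomomorphism _⟶_ G s t x y
  esp-homomorphism dense (single arc) x⟶y = singleArc-homomorphism arc x⟶y
  esp-homomorphism dense (parallel esp₁ esp₂ g) x⟶y =
    parallel-homomorphism g (esp-homomorphism dense esp₁ x⟶y) (esp-homomorphism dense esp₂ x⟶y)
  esp-homomorphism dense (series esp₁ esp₂ g) x⟶y =
    let _ , x⟶m , m⟶y = dense x⟶y
    in  series-homomorphism g (esp-homomorphism dense esp₁ x⟶m) (esp-homomorphism dense esp₂ m⟶y)

esp-orientedColorable : {_⟶_ : Rel (Fin r) ℓ} → Asymmetric _⟶_ → Dense _⟶_ → ∃₂ _⟶_ →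
                        ∀ {s t} → IsEsp G s t → OrientedColorable G r
esp-orientedColorable {_⟶_ = _⟶_} asym dense (_ , _ , x⟶y) esp =
  map , homomorphism⇒orientedColoring {_⟶_ = _⟶_} asym isHomomorphism
  where open TerminalHomomorphism (esp-homomorphism dense esp x⟶y)

-- Subtraction-free form of: y − x is a nonzero square modulo n.
Paley : ∀ n .{{_ : NonZero n}} → Rel (Fin n) 0ℓ
Paley n x y = x ≢ y × ∃ λ (q : Fin n) → toℕ y ≡ (toℕ x + toℕ q * toℕ q) % n

paley? : ∀ n .{{_ : NonZero n}} x y → Dec (Paley n x y)
paley? n x y = ¬? (x ≟ y) ×-dec any? λ q → toℕ y ℕ.≟ (toℕ x + toℕ q * toℕ q) % n

paley₇-asymmetric : Asymmetric (Paley 7)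
paley₇-asymmetric {x} {y} =
  from-yes (all? λ u → all? λ v → paley? 7 u v →-dec ¬? (paley? 7 v u)) x y

paley₇-dense : Dense (Paley 7)
paley₇-dense {x} {y} =
  from-yes (all? λ u → all? λ v → paley? 7 u v →-dec any? λ m → paley? 7 u m ×-dec paley? 7 m v) x y

theorem3 : (G : Digraph) (s t : Vertex G) → IsEsp G s t →
    ∃ λ χ → IsOrientedChromaticNumber G χ × χ ≤ 7
theorem3 G s t esp =
  let 0⟶1               = from-yes (paley? 7 (# 0) (# 1))
      colorable₇        = esp-orientedColorable paley₇-asymmetric paley₇-dense (# 0 , # 1 , 0⟶1) esp
      χ , χ-isChromatic = orientedColorable⇒∃chromaticNumber colorable₇
  in  χ , χ-isChromatic , IsOrientedChromaticNumber.smallest χ-isChromatic 7 colorable₇
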